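{- Let $d \geq 2$ be an integer and let $A = \mathbb{Z}[di] = \{a + b\,di : a, b \in \mathbb{Z}\} \subset \mathbb{C}$, where $i^2=-1$. Then $E_2(A)$ is a subgroup of infinite index in $SL_2(A)$, and $E_2(A)$ is not a normal subgroup of $SL_2(A)$.
   Context: For a commutative ring $A$, $E_2(A)$ denotes the subgroup of $SL_2(A)$ generated by the elementary matrices, i.e. the matrices $\begin{pmatrix} 1 & x \\ 0 & 1\end{pmatrix}$ and $\begin{pmatrix} 1 & 0 \\ x & 1\end{pmatrix}$ with $x \in A$. -}

module Defs where

open import Level using (Level; _⊔_; suc; 0ℓ)
open import Algebra.Bundles using (Group; CommutativeRing)
import Algebra.Properties.Group as GroupProperties
import Algebra.Properties.Ring as RingProperties
import Algebra.Solver.Ring.NaturalCoefficients.Default as NaturalCoefficientsSolver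
open import Data.Integer.Base using (ℤ; +_; 0ℤ; 1ℤ)
import Data.Integer.Base as ℤᵇ
import Data.Integer.Properties as ℤₚ
import Data.Integer.Tactic.RingSolver as ℤ-Solver
open import Data.Nat.Base using (ℕ)
open import Data.Product.Base using (∃; _,_)
open import Data.Sum.Base using (_⊎_)
open import Function.Bundles using (Injection)
open import Relation.Binary.Bundles using (Setoid)
open import Relation.Binary.PropositionalEquality as ≡ using (_≡_)
open import Relation.Unary using (Pred; _∈_)
import Relation.Binary.Reasoning.Setoid as SetoidReasoning

------------------------------------------------------------------------
-- Subgroups

record Subgroup {c ℓ} (G : Group c ℓ) (p : Level) : Set (c ⊔ ℓ ⊔ suc p) where
  open Group G
  field
    Member    : Pred Carrier p
    resp-≈    : ∀ {x y} → x ≈ y → x ∈ Member → y ∈ Member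
    ε-closed  : ε ∈ Member
    ∙-closed  : ∀ {x y} → x ∈ Member → y ∈ Member → (x ∙ y) ∈ Member
    ⁻¹-closed : ∀ {x} → x ∈ Member → (x ⁻¹) ∈ Member

module _ {c ℓ} (G : Group c ℓ) where
  open Group G

  data Generated {p} (S : Pred Carrier p) : Pred Carrier (c ⊔ ℓ ⊔ p) where
    gen  : ∀ {x} → x ∈ S → x ∈ Generated S
    resp : ∀ {x y} → x ≈ y → x ∈ Generated S → y ∈ Generated S
    unit : ε ∈ Generated S
    mul  : ∀ {x y} → x ∈ Generated S → y ∈ Generated S → (x ∙ y) ∈ Generated S
    inv  : ∀ {x} → x ∈ Generated S → (x ⁻¹) ∈ Generated S

  generatedSubgroup : ∀ {p} → Pred Carrier p → Subgroup G (c ⊔ ℓ ⊔ p)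
  generatedSubgroup S = record
    { Member    = Generated S
    ; resp-≈    = resp
    ; ε-closed  = unit
    ; ∙-closed  = mul
    ; ⁻¹-closed = inv
    }

module _ {c ℓ p} {G : Group c ℓ} (H : Subgroup G p) where
  open Group G
  open Subgroup H
  open GroupProperties G using (⁻¹-anti-homo-∙; ⁻¹-involutive)

  -- The set G/H of left cosets, each coset gH being represented by g:
  -- xH = yH if and only if x⁻¹y ∈ H.
  leftCosets : Setoid c p
  leftCosets = record
    { Carrier       = Carrier
    ; _≈_           = λ x y → (x ⁻¹ ∙ y) ∈ Member
    ; isEquivalence = record
      { refl  = λ {x} → resp-≈ (sym (inverseˡ x)) ε-closed
      ; sym   = λ {x} {y} m → resp-≈
          (trans (⁻¹-anti-homo-∙ (x ⁻¹) y) (∙-congˡ (⁻¹-involutive x)))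
          (⁻¹-closed m)
      ; trans = λ {x} {y} {z} m n → resp-≈ (cancel x y z) (∙-closed m n)
      }
    }
    where
    cancel : ∀ x y z → (x ⁻¹ ∙ y) ∙ (y ⁻¹ ∙ z) ≈ x ⁻¹ ∙ z
    cancel x y z = begin
      (x ⁻¹ ∙ y) ∙ (y ⁻¹ ∙ z)  ≈⟨ assoc _ _ _ ⟩
      x ⁻¹ ∙ (y ∙ (y ⁻¹ ∙ z))  ≈⟨ ∙-congˡ (assoc _ _ _) ⟨
      x ⁻¹ ∙ ((y ∙ y ⁻¹) ∙ z)  ≈⟨ ∙-congˡ (∙-congʳ (inverseʳ y)) ⟩
      x ⁻¹ ∙ (ε ∙ z)           ≈⟨ ∙-congˡ (identityˡ z) ⟩
      x ⁻¹ ∙ z                 ∎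
      where open SetoidReasoning setoid

  -- Infinitude of G/H in its constructively strong form: there is a
  -- sequence of pairwise distinct left cosets.
  HasInfiniteIndex : Set (c ⊔ p)
  HasInfiniteIndex = Injection (≡.setoid ℕ) leftCosets

  IsNormal : Set (c ⊔ p)
  IsNormal = ∀ g {h} → h ∈ Member → ((g ∙ h) ∙ g ⁻¹) ∈ Member

------------------------------------------------------------------------
-- SL₂ and E₂ over a commutative ring

module _ {r ℓ} (A : CommutativeRing r ℓ) where
  open CommutativeRing A

  record SL₂-Matrix : Set (r ⊔ ℓ) where
    constructor mat
    field
      e₁₁ e₁₂ e₂₁ e₂₂ : Carrier
      det≈1           : e₁₁ * e₂₂ - e₁₂ * e₂₁ ≈ 1#

  record _≈ᴹ_ (M N : SL₂-Matrix) : Set ℓ where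
    constructor mk≈
    private
      module M = SL₂-Matrix M
      module N = SL₂-Matrix N
    field
      e₁₁≈ : M.e₁₁ ≈ N.e₁₁
      e₁₂≈ : M.e₁₂ ≈ N.e₁₂
      e₂₁≈ : M.e₂₁ ≈ N.e₂₁
      e₂₂≈ : M.e₂₂ ≈ N.e₂₂

  private
    open SetoidReasoning setoid
    open GroupProperties +-group using (⁻¹-involutive; //-rightDividesˡ; //-rightDividesʳ)
    open RingProperties ring using (-‿distribˡ-*; -‿distribʳ-*)
    open NaturalCoefficientsSolver commutativeSemiring using (solve; _:=_; _:+_; _:*_; con)

    x-y≈1⇒x≈1+y : ∀ {x y} → x - y ≈ 1# → x ≈ 1# + y
    x-y≈1⇒x≈1+y {x} {y} p = trans (sym (//-rightDividesˡ y x)) (+-congʳ p)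

    x≈1+y⇒x-y≈1 : ∀ {x y} → x ≈ 1# + y → x - y ≈ 1#
    x≈1+y⇒x-y≈1 {x} {y} p = trans (+-congʳ p) (//-rightDividesʳ y 1#)

    1x+0y : ∀ x y → 1# * x + 0# * y ≈ x
    1x+0y x y = trans (+-cong (*-identityˡ x) (zeroˡ y)) (+-identityʳ x)

    0x+1y : ∀ x y → 0# * x + 1# * y ≈ y
    0x+1y x y = trans (+-cong (zeroˡ x) (*-identityˡ y)) (+-identityˡ y)

    x1+y0 : ∀ x y → x * 1# + y * 0# ≈ x
    x1+y0 x y = trans (+-cong (*-identityʳ x) (zeroʳ y)) (+-identityʳ x)

    x0+y1 : ∀ x y → x * 0# + y * 1# ≈ y
    x0+y1 x y = trans (+-cong (zeroʳ x) (*-identityʳ y)) (+-identityˡ y)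

    minus0 : ∀ {x y} → x ≈ 1# → y ≈ 0# → x - y ≈ 1#
    minus0 x≈1 y≈0 = x≈1+y⇒x-y≈1 (trans x≈1 (sym (trans (+-congˡ y≈0) (+-identityʳ 1#))))

    det-∙ : ∀ a b c d a′ b′ c′ d′ → a * d - b * c ≈ 1# → a′ * d′ - b′ * c′ ≈ 1# →
      (a * a′ + b * c′) * (c * b′ + d * d′) - (a * b′ + b * d′) * (c * a′ + d * c′) ≈ 1#
    det-∙ a b c d a′ b′ c′ d′ p p′ = x≈1+y⇒x-y≈1 (begin
      (a * a′ + b * c′) * (c * b′ + d * d′)
        ≈⟨ solve 8 (λ a b c d a′ b′ c′ d′ →
             (a :* a′ :+ b :* c′) :* (c :* b′ :+ d :* d′)
             := (a :* d) :* (a′ :* d′) :+ (b :* c) :* (b′ :* c′)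
                :+ (a :* a′ :* c :* b′ :+ b :* d′ :* d :* c′))
             refl a b c d a′ b′ c′ d′ ⟩
      (a * d) * (a′ * d′) + (b * c) * (b′ * c′) + t
        ≈⟨ +-congʳ (+-congʳ (*-cong q q′)) ⟩
      (1# + b * c) * (1# + b′ * c′) + (b * c) * (b′ * c′) + t
        ≈⟨ solve 3 (λ u v t →
             (con 1 :+ u) :* (con 1 :+ v) :+ u :* v :+ t
             := con 1 :+ ((con 1 :+ u) :* v :+ u :* (con 1 :+ v) :+ t))
             refl (b * c) (b′ * c′) t ⟩
      1# + ((1# + b * c) * (b′ * c′) + (b * c) * (1# + b′ * c′) + t)
        ≈⟨ +-congˡ (+-congʳ (+-cong (*-congʳ q) (*-congˡ q′))) ⟨
      1# + ((a * d) * (b′ * c′) + (b * c) * (a′ * d′) + t)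
        ≈⟨ +-congˡ (solve 8 (λ a b c d a′ b′ c′ d′ →
             (a :* d) :* (b′ :* c′) :+ (b :* c) :* (a′ :* d′)
                :+ (a :* a′ :* c :* b′ :+ b :* d′ :* d :* c′)
             := (a :* b′ :+ b :* d′) :* (c :* a′ :+ d :* c′))
             refl a b c d a′ b′ c′ d′) ⟩
      1# + (a * b′ + b * d′) * (c * a′ + d * c′) ∎)
      where
      t  = a * a′ * c * b′ + b * d′ * d * c′
      q  = x-y≈1⇒x≈1+y p
      q′ = x-y≈1⇒x≈1+y p′

    det-adj : ∀ a b c d → d * a - (- b) * (- c) ≈ a * d - b * c
    det-adj a b c d = +-cong (*-comm d a) (-‿cong -b*-c≈b*c)
      where
      -b*-c≈b*c : (- b) * (- c) ≈ b * c
      -b*-c≈b*c = trans (sym (-‿distribˡ-* b (- c)))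
        (trans (-‿cong (sym (-‿distribʳ-* b c))) (⁻¹-involutive (b * c)))

    assoc-entry : ∀ x y a b c d z w →
      (x * a + y * c) * z + (x * b + y * d) * w ≈ x * (a * z + b * w) + y * (c * z + d * w)
    assoc-entry = solve 8 (λ x y a b c d z w →
      (x :* a :+ y :* c) :* z :+ (x :* b :+ y :* d) :* w
      := x :* (a :* z :+ b :* w) :+ y :* (c :* z :+ d :* w)) refl

    x*-y : ∀ x y → x * (- y) ≈ - (x * y)
    x*-y x y = sym (-‿distribʳ-* x y)

    -x*y : ∀ x y → (- x) * y ≈ - (x * y)
    -x*y x y = sym (-‿distribˡ-* x y)

    adj-ad : ∀ a b c d → a * d + b * (- c) ≈ a * d - b * c
    adj-ad a b c d = +-congˡ (x*-y b c)

    adj-da : ∀ a b c d → d * a + (- b) * c ≈ a * d - b * c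
    adj-da a b c d = +-cong (*-comm d a) (-x*y b c)

    adj-cb : ∀ a b c d → c * (- b) + d * a ≈ a * d - b * c
    adj-cb a b c d = trans (+-comm _ _)
      (+-cong (*-comm d a) (trans (x*-y c b) (-‿cong (*-comm c b))))

    adj-bc : ∀ a b c d → (- c) * b + a * d ≈ a * d - b * c
    adj-bc a b c d = trans (+-comm _ _) (+-congˡ (trans (-x*y c b) (-‿cong (*-comm c b))))

    xy-yx : ∀ x y → x * y + (- y) * x ≈ 0#
    xy-yx x y = trans (+-congˡ (trans (-x*y y x) (-‿cong (*-comm y x)))) (-‿inverseʳ _)

    -xy+yx : ∀ x y → (- x) * y + y * x ≈ 0#
    -xy+yx x y = trans (+-cong (-x*y x y) (*-comm y x)) (-‿inverseˡ _)

    x-y+yx : ∀ x y → x * (- y) + y * x ≈ 0#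
    x-y+yx x y = trans (+-cong (x*-y x y) (*-comm y x)) (-‿inverseˡ _)

    xy+y-x : ∀ x y → x * y + y * (- x) ≈ 0#
    xy+y-x x y = trans (+-congˡ (trans (x*-y y x) (-‿cong (*-comm y x)))) (-‿inverseʳ _)

  _∙ᴹ_ : SL₂-Matrix → SL₂-Matrix → SL₂-Matrix
  mat a b c d p ∙ᴹ mat a′ b′ c′ d′ q = mat
    (a * a′ + b * c′) (a * b′ + b * d′)
    (c * a′ + d * c′) (c * b′ + d * d′)
    (det-∙ a b c d a′ b′ c′ d′ p q)

  1ᴹ : SL₂-Matrix
  1ᴹ = mat 1# 0# 0# 1# (minus0 (*-identityˡ 1#) (zeroˡ 0#))

  _⁻¹ᴹ : SL₂-Matrix → SL₂-Matrix
  mat a b c d p ⁻¹ᴹ = mat d (- b) (- c) a (trans (det-adj a b c d) p)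

  SL₂ : Group (r ⊔ ℓ) ℓ
  SL₂ = record
    { Carrier = SL₂-Matrix
    ; _≈_     = _≈ᴹ_
    ; _∙_     = _∙ᴹ_
    ; ε       = 1ᴹ
    ; _⁻¹     = _⁻¹ᴹ
    ; isGroup = record
      { isMonoid = record
        { isSemigroup = record
          { isMagma = record
            { isEquivalence = record
              { refl  = mk≈ refl refl refl refl
              ; sym   = λ { (mk≈ p q r s) → mk≈ (sym p) (sym q) (sym r) (sym s) }
              ; trans = λ { (mk≈ p q r s) (mk≈ p′ q′ r′ s′) →
                  mk≈ (trans p p′) (trans q q′) (trans r r′) (trans s s′) }
              }
            ; ∙-cong = λ { (mk≈ p q r s) (mk≈ p′ q′ r′ s′) → mk≈
                (+-cong (*-cong p p′) (*-cong q r′))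
                (+-cong (*-cong p q′) (*-cong q s′))
                (+-cong (*-cong r p′) (*-cong s r′))
                (+-cong (*-cong r q′) (*-cong s s′)) }
            }
          ; assoc = λ { (mat a b c d _) (mat a′ b′ c′ d′ _) (mat a″ b″ c″ d″ _) → mk≈
              (assoc-entry a b a′ b′ c′ d′ a″ c″)
              (assoc-entry a b a′ b′ c′ d′ b″ d″)
              (assoc-entry c d a′ b′ c′ d′ a″ c″)
              (assoc-entry c d a′ b′ c′ d′ b″ d″) }
          }
        ; identity =
            (λ { (mat a b c d _) → mk≈ (1x+0y a c) (1x+0y b d) (0x+1y a c) (0x+1y b d) })
          , (λ { (mat a b c d _) → mk≈ (x1+y0 a b) (x0+y1 a b) (x1+y0 c d) (x0+y1 c d) })
        }
      ; inverse =
          (λ { (mat a b c d p) → mk≈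
            (trans (adj-da a b c d) p)
            (xy-yx d b)
            (-xy+yx c a)
            (trans (adj-bc a b c d) p) })
        , (λ { (mat a b c d p) → mk≈
            (trans (adj-ad a b c d) p)
            (x-y+yx a b)
            (xy+y-x c d)
            (trans (adj-cb a b c d) p) })
      ; ⁻¹-cong = λ { (mk≈ p q r s) → mk≈ s (-‿cong q) (-‿cong r) p }
      }
    }

  upper lower : Carrier → SL₂-Matrix
  upper x = mat 1# x 0# 1# (minus0 (*-identityˡ 1#) (zeroʳ x))
  lower x = mat 1# 0# x 1# (minus0 (*-identityˡ 1#) (zeroˡ x))

  IsElementary : Pred SL₂-Matrix (r ⊔ ℓ)
  IsElementary M = ∃ λ x → (M ≈ᴹ upper x) ⊎ (M ≈ᴹ lower x)

  E₂ : Subgroup SL₂ (r ⊔ ℓ)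
  E₂ = generatedSubgroup SL₂ IsElementary

------------------------------------------------------------------------
-- The ring ℤ[di]

-- re + im di stands for the complex number re + im·(di); since di ∉ ℝ
-- for d ≥ 1, the integers re and im are determined by that number, and
-- equality of elements is equality of both coordinates.
record ℤ[_i] (d : ℕ) : Set where
  constructor _+_di
  field
    re im : ℤ

module _ {d : ℕ} where

  infixl 6 _+ᶻ_
  infixl 7 _*ᶻ_

  _+ᶻ_ : ℤ[ d i] → ℤ[ d i] → ℤ[ d i]
  (a + b di) +ᶻ (a′ + b′ di) = (a ℤᵇ.+ a′) + (b ℤᵇ.+ b′) di

  -- (di)² = - d²
  _*ᶻ_ : ℤ[ d i] → ℤ[ d i] → ℤ[ d i]
  (a + b di) *ᶻ (a′ + b′ di) =
    (a ℤᵇ.* a′ ℤᵇ.- (+ d ℤᵇ.* + d) ℤᵇ.* (b ℤᵇ.* b′)) + (a ℤᵇ.* b′ ℤᵇ.+ b ℤᵇ.* a′) di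

  -ᶻ_ : ℤ[ d i] → ℤ[ d i]
  -ᶻ (a + b di) = (ℤᵇ.- a) + (ℤᵇ.- b) di

  0ᶻ 1ᶻ : ℤ[ d i]
  0ᶻ = 0ℤ + 0ℤ di
  1ᶻ = 1ℤ + 0ℤ di

private
  open ℤᵇ using (_+_; _*_; _-_)

  assoc-re : ∀ e a b a′ b′ a″ b″ →
    (a * a′ - e * (b * b′)) * a″ - e * ((a * b′ + b * a′) * b″)
    ≡ a * (a′ * a″ - e * (b′ * b″)) - e * (b * (a′ * b″ + b′ * a″))
  assoc-re = ℤ-Solver.solve-∀

  assoc-im : ∀ e a b a′ b′ a″ b″ →
    (a * a′ - e * (b * b′)) * b″ + (a * b′ + b * a′) * a″
    ≡ a * (a′ * b″ + b′ * a″) + b * (a′ * a″ - e * (b′ * b″))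
  assoc-im = ℤ-Solver.solve-∀

  comm-re : ∀ e a b a′ b′ → a * a′ - e * (b * b′) ≡ a′ * a - e * (b′ * b)
  comm-re = ℤ-Solver.solve-∀

  comm-im : ∀ a b a′ b′ → a * b′ + b * a′ ≡ a′ * b + b′ * a
  comm-im = ℤ-Solver.solve-∀

  distrib-re : ∀ e a b a′ b′ a″ b″ →
    a * (a′ + a″) - e * (b * (b′ + b″))
    ≡ (a * a′ - e * (b * b′)) + (a * a″ - e * (b * b″))
  distrib-re = ℤ-Solver.solve-∀

  distrib-im : ∀ a b a′ b′ a″ b″ →
    a * (b′ + b″) + b * (a′ + a″) ≡ (a * b′ + b * a′) + (a * b″ + b * a″)
  distrib-im = ℤ-Solver.solve-∀

  identity-re : ∀ e a b → 1ℤ * a - e * (0ℤ * b) ≡ a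
  identity-re = ℤ-Solver.solve-∀

  identity-im : ∀ a b → 1ℤ * b + 0ℤ * a ≡ b
  identity-im = ℤ-Solver.solve-∀

ℤ[di]-commutativeRing : ℕ → CommutativeRing 0ℓ 0ℓ
ℤ[di]-commutativeRing d = record
  { Carrier = ℤ[ d i]
  ; _≈_     = _≡_
  ; _+_     = _+ᶻ_
  ; _*_     = _*ᶻ_
  ; -_      = -ᶻ_
  ; 0#      = 0ᶻ
  ; 1#      = 1ᶻ
  ; isCommutativeRing = record
    { isRing = record
      { +-isAbelianGroup = record
        { isGroup = record
          { isMonoid = record
            { isSemigroup = record
              { isMagma = record
                { isEquivalence = ≡.isEquivalence
                ; ∙-cong        = ≡.cong₂ _+ᶻ_
                }
              ; assoc = λ { (a + b di) (a′ + b′ di) (a″ + b″ di) →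
                  ≡.cong₂ _+_di (ℤₚ.+-assoc a a′ a″) (ℤₚ.+-assoc b b′ b″) }
              }
            ; identity =
                (λ { (a + b di) → ≡.cong₂ _+_di (ℤₚ.+-identityˡ a) (ℤₚ.+-identityˡ b) })
              , (λ { (a + b di) → ≡.cong₂ _+_di (ℤₚ.+-identityʳ a) (ℤₚ.+-identityʳ b) })
            }
          ; inverse =
              (λ { (a + b di) → ≡.cong₂ _+_di (ℤₚ.+-inverseˡ a) (ℤₚ.+-inverseˡ b) })
            , (λ { (a + b di) → ≡.cong₂ _+_di (ℤₚ.+-inverseʳ a) (ℤₚ.+-inverseʳ b) })
          ; ⁻¹-cong = ≡.cong -ᶻ_
          }
        ; comm = λ { (a + b di) (a′ + b′ di) →
            ≡.cong₂ _+_di (ℤₚ.+-comm a a′) (ℤₚ.+-comm b b′) }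
        }
      ; *-cong     = ≡.cong₂ _*ᶻ_
      ; *-assoc    = λ { (a + b di) (a′ + b′ di) (a″ + b″ di) → ≡.cong₂ _+_di
          (assoc-re (+ d * + d) a b a′ b′ a″ b″) (assoc-im (+ d * + d) a b a′ b′ a″ b″) }
      ; *-identity = identityˡ , λ x → ≡.trans (comm x 1ᶻ) (identityˡ x)
      ; distrib    = distribˡ , λ x y z → ≡.trans (comm (y +ᶻ z) x)
          (≡.trans (distribˡ x y z) (≡.cong₂ _+ᶻ_ (comm x y) (comm x z)))
      }
    ; *-comm = comm
    }
  }
  where
  comm : ∀ (x y : ℤ[ d i]) → x *ᶻ y ≡ y *ᶻ x
  comm (a + b di) (a′ + b′ di) =
    ≡.cong₂ _+_di (comm-re (+ d * + d) a b a′ b′) (comm-im a b a′ b′)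

  identityˡ : ∀ (x : ℤ[ d i]) → 1ᶻ *ᶻ x ≡ x
  identityˡ (a + b di) = ≡.cong₂ _+_di (identity-re (+ d * + d) a b) (identity-im a b)

  distribˡ : ∀ (x y z : ℤ[ d i]) → x *ᶻ (y +ᶻ z) ≡ x *ᶻ y +ᶻ x *ᶻ z
  distribˡ (a + b di) (a′ + b′ di) (a″ + b″ di) = ≡.cong₂ _+_di
    (distrib-re (+ d * + d) a b a′ b′ a″ b″) (distrib-im a b a′ b′ a″ b″)

{-# OPTIONS --safe #-}
-- Every element of ℤ[di] other than 0 and ±1 has norm at least 4, so a word in the
-- matrices E(x) = (x 1 ; -1 0) can be shortened until all its inner letters have norm at
-- least 4, and multiplying a row by such letters makes its entries grow.  Hence if no
-- Euclidean division step shrinks the row (α , β), then no row in its E₂-orbit has a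
-- second entry of norm less than ‖β‖.  For d ≥ 2, such irreducible unimodular rows exist
-- with arbitrarily large ‖β‖, because α / β can be taken with imaginary part d/2.
-- Different values of ‖β‖ give different cosets of E₂, and since the row (1 , 0) has
-- second entry 0, a conjugate of an elementary matrix whose first row is irreducible
-- with β ≠ 0 lies outside E₂.

module Submission where

open import Defs
open import Algebra.Bundles using (CommutativeRing; Group)
import Algebra.Properties.Group as GroupProperties
import Algebra.Solver.Ring as RingSolver
open import Algebra.Solver.Ring.AlmostCommutativeRing
  using (_-Raw-AlmostCommutative⟶_; fromCommutativeRing)
open import Data.Integer.Base as ℤ using (ℤ; +_; -[1+_]; 0ℤ; 1ℤ; -1ℤ; +≤+)
import Data.Integer.Properties as ℤ
import Data.Integer.Tactic.RingSolver as ℤ-Solver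
open import Data.Nat.Base as ℕ using (ℕ; suc; z≤n; s≤s; _≤_)
import Data.Nat.Properties as ℕ
open import Data.Product.Base using (_×_; _,_; proj₁; proj₂)
open import Data.Sum.Base using (_⊎_; inj₁; inj₂)
open import Level using (0ℓ)
open import Relation.Binary.Bundles using (Setoid)
open import Relation.Binary.PropositionalEquality
  using (_≡_; _≢_; refl; sym; trans; cong; cong₂; subst; subst₂)
open import Relation.Nullary using (Dec; yes; no)
open import Relation.Nullary.Decidable using (map′; dec⇒maybe)
open import Relation.Nullary.Negation.Core using (¬_; contradiction)
open import Relation.Unary using (Pred; _∈_)

-- Predicates stable under a generated subgroup.

module _ {c ℓ s p} {G : Group c ℓ} {S : Pred (Group.Carrier G) s} (P : Pred (Group.Carrier G) p) where
  open Group G renaming (sym to ≈-sym)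
  open GroupProperties G using (ε⁻¹≈ε; ⁻¹-anti-homo-∙; ⁻¹-involutive)

  generated-stable :
    (∀ {x y} → x ≈ y → P x → P y) →
    (∀ {g x} → g ∈ S → P x → P (x ∙ g)) →
    (∀ {g x} → g ∈ S → P x → P (x ∙ g ⁻¹)) →
    ∀ {h x} → h ∈ Generated G S → P x → P (x ∙ h)
  generated-stable P-resp P-gen P-gen⁻¹ h∈ = proj₁ (both h∈)
    where
    -- Induction on `h` alone fails at `inv`, so the claims for `h` and `h ⁻¹` are proved together
    -- and `inv` swaps them.
    both : ∀ {h} → h ∈ Generated G S → (∀ {x} → P x → P (x ∙ h)) × (∀ {x} → P x → P (x ∙ h ⁻¹))
    both (gen g∈)      = P-gen g∈ , P-gen⁻¹ g∈
    both (resp g≈h g∈) =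
        (λ Px → P-resp (∙-congˡ g≈h) (proj₁ (both g∈) Px))
      , (λ Px → P-resp (∙-congˡ (⁻¹-cong g≈h)) (proj₂ (both g∈) Px))
    both unit          =
        (λ Px → P-resp (≈-sym (identityʳ _)) Px)
      , (λ Px → P-resp (≈-sym (Group.trans G (∙-congˡ ε⁻¹≈ε) (identityʳ _))) Px)
    both (mul g∈ h∈)   =
        (λ Px → P-resp (assoc _ _ _) (proj₁ (both h∈) (proj₁ (both g∈) Px)))
      , (λ Px → P-resp
          (Group.trans G (assoc _ _ _) (∙-congˡ (≈-sym (⁻¹-anti-homo-∙ _ _))))
          (proj₂ (both g∈) (proj₂ (both h∈) Px)))
    both (inv g∈)      =
        proj₂ (both g∈)
      , (λ Px → P-resp (∙-congˡ (≈-sym (⁻¹-involutive _))) (proj₁ (both g∈) Px))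

-- Integer inequalities.

0≤i*j : ∀ {i j} → 0ℤ ℤ.≤ i → 0ℤ ℤ.≤ j → 0ℤ ℤ.≤ i ℤ.* j
0≤i*j {+ m} {+ n} _ _ = subst (0ℤ ℤ.≤_) (ℤ.pos-* m n) (+≤+ z≤n)

0≤i+j : ∀ {i j} → 0ℤ ℤ.≤ i → 0ℤ ℤ.≤ j → 0ℤ ℤ.≤ i ℤ.+ j
0≤i+j = ℤ.+-mono-≤

n≤∣i∣⇒n*n≤i*i : ∀ {n} i → n ≤ ℤ.∣ i ∣ → + (n ℕ.* n) ℤ.≤ i ℤ.* i
n≤∣i∣⇒n*n≤i*i (+ m)    n≤m = subst (_ ℤ.≤_) (ℤ.pos-* m m) (+≤+ (ℕ.*-mono-≤ n≤m n≤m))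
n≤∣i∣⇒n*n≤i*i -[1+ m ] n≤m = +≤+ (ℕ.*-mono-≤ n≤m n≤m)

0≤i*i : ∀ i → 0ℤ ℤ.≤ i ℤ.* i
0≤i*i i = n≤∣i∣⇒n*n≤i*i i z≤n

-- No integer lies strictly between -1 and 0, the only range where the product is negative.
0≤i*[i+1] : ∀ i → 0ℤ ℤ.≤ i ℤ.* (i ℤ.+ 1ℤ)
0≤i*[i+1] (+ n)          = 0≤i*j {+ n} {+ n ℤ.+ 1ℤ} (+≤+ z≤n) (+≤+ z≤n)
0≤i*[i+1] -[1+ 0 ]       = +≤+ z≤n
0≤i*[i+1] -[1+ suc n ]   = +≤+ z≤n

-- The integers inside ℤ[di], and a ring solver.

fromℤ : ∀ {d} → ℤ → ℤ[ d i]
fromℤ a = a + 0ℤ di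

fromℤ-* : ∀ {d} n a b → fromℤ {d} n *ᶻ (a + b di) ≡ (n ℤ.* a) + (n ℤ.* b) di
fromℤ-* {d} n a b = cong₂ _+_di (re (+ d ℤ.* + d) n a b) (im n a b)
  where
  -- Here and below, d² is generalised to `e`, which leaves a polynomial identity over `ℤ`.
  re : ∀ e n a b → n ℤ.* a ℤ.- e ℤ.* (0ℤ ℤ.* b) ≡ n ℤ.* a
  re = ℤ-Solver.solve-∀

  im : ∀ n a b → n ℤ.* b ℤ.+ 0ℤ ℤ.* a ≡ n ℤ.* b
  im = ℤ-Solver.solve-∀

module Solver (d : ℕ) where
  private
    morphism : CommutativeRing.rawRing ℤ.+-*-commutativeRing
      -Raw-AlmostCommutative⟶ fromCommutativeRing (ℤ[di]-commutativeRing d)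
    morphism = record
      { ⟦_⟧    = fromℤ
      ; +-homo = λ _ _ → refl
      ; *-homo = λ a b → sym (trans (fromℤ-* a b 0ℤ) (cong (λ c → (a ℤ.* b) + c di) (ℤ.*-zeroʳ a)))
      ; -‿homo = λ _ → refl
      ; 0-homo = refl
      ; 1-homo = refl
      }

    fromℤ≟ : ∀ a b → Dec (fromℤ {d} a ≡ fromℤ b)
    fromℤ≟ a b = map′ (cong fromℤ) (cong ℤ[_i].re) (a ℤ.≟ b)

  open RingSolver _ _ morphism (λ a b → dec⇒maybe (fromℤ≟ a b)) public

-- The norm and its growth.

norm : ∀ {d} → ℤ[ d i] → ℤ
norm {d} (a + b di) = a ℤ.* a ℤ.+ (+ d ℤ.* + d) ℤ.* (b ℤ.* b)

module _ {d : ℕ} where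

  open Solver d

  0≤norm : (x : ℤ[ d i]) → 0ℤ ℤ.≤ norm x
  0≤norm (a + b di) = 0≤i+j (0≤i*i a) (0≤i*j (0≤i*i (+ d)) (0≤i*i b))

  norm-neg : (x : ℤ[ d i]) → norm (-ᶻ x) ≡ norm x
  norm-neg (a + b di) = lemma (+ d ℤ.* + d) a b
    where
    lemma : ∀ e a b → ℤ.- a ℤ.* ℤ.- a ℤ.+ e ℤ.* (ℤ.- b ℤ.* ℤ.- b) ≡ a ℤ.* a ℤ.+ e ℤ.* (b ℤ.* b)
    lemma = ℤ-Solver.solve-∀

  norm-* : (x y : ℤ[ d i]) → norm (x *ᶻ y) ≡ norm x ℤ.* norm y
  norm-* (a + b di) (a′ + b′ di) = lemma (+ d ℤ.* + d) a b a′ b′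
    where
    lemma : ∀ e a b a′ b′ →
      (a ℤ.* a′ ℤ.- e ℤ.* (b ℤ.* b′)) ℤ.* (a ℤ.* a′ ℤ.- e ℤ.* (b ℤ.* b′))
        ℤ.+ e ℤ.* ((a ℤ.* b′ ℤ.+ b ℤ.* a′) ℤ.* (a ℤ.* b′ ℤ.+ b ℤ.* a′))
      ≡ (a ℤ.* a ℤ.+ e ℤ.* (b ℤ.* b)) ℤ.* (a′ ℤ.* a′ ℤ.+ e ℤ.* (b′ ℤ.* b′))
    lemma = ℤ-Solver.solve-∀

  parallelogram : (u p : ℤ[ d i]) →
    norm u ℤ.+ norm (u +ᶻ -ᶻ p +ᶻ -ᶻ p) ≡ + 2 ℤ.* norm (u +ᶻ -ᶻ p) ℤ.+ + 2 ℤ.* norm p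
  parallelogram (a + b di) (a′ + b′ di) = lemma (+ d ℤ.* + d) a b a′ b′
    where
    lemma : ∀ e a b a′ b′ →
      (a ℤ.* a ℤ.+ e ℤ.* (b ℤ.* b))
        ℤ.+ ((a ℤ.- a′ ℤ.- a′) ℤ.* (a ℤ.- a′ ℤ.- a′)
             ℤ.+ e ℤ.* ((b ℤ.- b′ ℤ.- b′) ℤ.* (b ℤ.- b′ ℤ.- b′)))
      ≡ + 2 ℤ.* ((a ℤ.- a′) ℤ.* (a ℤ.- a′) ℤ.+ e ℤ.* ((b ℤ.- b′) ℤ.* (b ℤ.- b′)))
        ℤ.+ + 2 ℤ.* (a′ ℤ.* a′ ℤ.+ e ℤ.* (b′ ℤ.* b′))
    lemma = ℤ-Solver.solve-∀

  Big : Pred ℤ[ d i] _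
  Big x = + 4 ℤ.≤ norm x

  -- In absolute values this is the triangle inequality |xq - p| ≥ 2|q| - |p| ≥ |q|. Applying the
  -- parallelogram law to xq - p and p avoids square roots.
  norm-growth : ∀ {x q p} → Big x → norm p ℤ.≤ norm q → norm q ℤ.≤ norm (x *ᶻ q +ᶻ -ᶻ p)
  norm-growth {x} {q} {p} big p≤q = ℤ.*-cancelˡ-≤-pos _ _ (+ 2) (ℤ.0≤i-j⇒j≤i (subst (0ℤ ℤ.≤_)
    (lemma (norm x) (norm q) (norm p) (norm w) (norm r)
      (trans (cong (ℤ._+ norm w) (sym (norm-* x q))) (parallelogram (x *ᶻ q) p)))
    (0≤i+j (0≤i+j (0≤i*j (ℤ.i≤j⇒0≤j-i big) (0≤norm q)) (0≤norm w))
      (0≤i*j {+ 2} (+≤+ z≤n) (ℤ.i≤j⇒0≤j-i p≤q)))))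
    where
    r = x *ᶻ q +ᶻ -ᶻ p
    w = r +ᶻ -ᶻ p

    rearrange₁ : ∀ x q p w →
      (x ℤ.- + 4) ℤ.* q ℤ.+ w ℤ.+ + 2 ℤ.* (q ℤ.- p) ≡ (x ℤ.* q ℤ.+ w) ℤ.- (+ 2 ℤ.* q ℤ.+ + 2 ℤ.* p)
    rearrange₁ = ℤ-Solver.solve-∀

    rearrange₂ : ∀ q p r → (+ 2 ℤ.* r ℤ.+ + 2 ℤ.* p) ℤ.- (+ 2 ℤ.* q ℤ.+ + 2 ℤ.* p) ≡ + 2 ℤ.* r ℤ.- + 2 ℤ.* q
    rearrange₂ = ℤ-Solver.solve-∀

    lemma : ∀ x q p w r → x ℤ.* q ℤ.+ w ≡ + 2 ℤ.* r ℤ.+ + 2 ℤ.* p →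
      (x ℤ.- + 4) ℤ.* q ℤ.+ w ℤ.+ + 2 ℤ.* (q ℤ.- p) ≡ + 2 ℤ.* r ℤ.- + 2 ℤ.* q
    lemma x q p w r eq = trans (rearrange₁ x q p w)
      (trans (cong (ℤ._- (+ 2 ℤ.* q ℤ.+ + 2 ℤ.* p)) eq) (rearrange₂ q p r))

  norm-fromℤ : ∀ a → norm (fromℤ {d} a) ≡ a ℤ.* a
  norm-fromℤ a = lemma (+ d ℤ.* + d) a
    where
    lemma : ∀ e a → a ℤ.* a ℤ.+ e ℤ.* (0ℤ ℤ.* 0ℤ) ≡ a ℤ.* a
    lemma = ℤ-Solver.solve-∀

  -- Elements of small norm.

  data Small : Pred ℤ[ d i] 0ℓ where
    is-0  : Small 0ᶻ
    is-1  : Small 1ᶻ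
    is--1 : Small (-ᶻ 1ᶻ)

  module _ (2≤d : 2 ≤ d) where

    4≤d*d : + 4 ℤ.≤ + d ℤ.* + d
    4≤d*d = n≤∣i∣⇒n*n≤i*i (+ d) 2≤d

    im≢0⇒big : ∀ a {b} → b ≢ 0ℤ → Big (a + b di)
    im≢0⇒big a {b} b≢0 = ℤ.+-mono-≤ (0≤i*i a) (ℤ.≤-trans 4≤d*d
      (subst (ℤ._≤ (+ d ℤ.* + d) ℤ.* (b ℤ.* b)) (ℤ.*-identityʳ _)
        (ℤ.*-monoˡ-≤-nonNeg (+ d ℤ.* + d) {{ℤ.nonNegative (0≤i*i (+ d))}}
          (n≤∣i∣⇒n*n≤i*i b (ℕ.n≢0⇒n>0 λ ∣b∣≡0 → b≢0 (ℤ.∣i∣≡0⇒i≡0 ∣b∣≡0))))))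

    2≤∣a∣⇒big : ∀ a → 2 ≤ ℤ.∣ a ∣ → Big (fromℤ a)
    2≤∣a∣⇒big a 2≤∣a∣ = subst (+ 4 ℤ.≤_) (sym (norm-fromℤ a)) (n≤∣i∣⇒n*n≤i*i a 2≤∣a∣)

    -- A nonzero imaginary part already contributes d² ≥ 4, so only the integers 0 and ±1 escape
    -- `Big`.
    big⊎small : ∀ x → Big x ⊎ Small x
    big⊎small (a + b di) with b ℤ.≟ 0ℤ
    ... | no b≢0   = inj₁ (im≢0⇒big a b≢0)
    big⊎small ((+ 0) + .0ℤ di)         | yes refl = inj₂ is-0
    big⊎small ((+ 1) + .0ℤ di)         | yes refl = inj₂ is-1
    big⊎small (a@(+ suc (suc _)) + .0ℤ di) | yes refl = inj₁ (2≤∣a∣⇒big a (s≤s (s≤s z≤n)))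
    big⊎small (-[1+ 0 ] + .0ℤ di)      | yes refl = inj₂ is--1
    big⊎small (a@(-[1+ suc _ ]) + .0ℤ di)  | yes refl = inj₁ (2≤∣a∣⇒big a (s≤s (s≤s z≤n)))

  ¬big : ∀ a → ℤ.∣ a ∣ ≤ 1 → ¬ Big (fromℤ a)
  ¬big a ∣a∣≤1 big = contradiction
    (ℤ.≤-trans (subst (+ 4 ℤ.≤_) (norm-fromℤ a) big) (≤1 a ∣a∣≤1)) λ { (+≤+ (s≤s ())) }
    where
    ≤1 : ∀ a → ℤ.∣ a ∣ ≤ 1 → a ℤ.* a ℤ.≤ 1ℤ
    ≤1 (+ 0)    _ = +≤+ z≤n
    ≤1 (+ 1)    _ = +≤+ (s≤s z≤n)
    ≤1 (+ suc (suc _)) (s≤s ())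
    ≤1 -[1+ 0 ] _ = +≤+ (s≤s z≤n)
    ≤1 -[1+ suc _ ] (s≤s ())

  -- Normal forms for the rows in an E₂-orbit.

  -- No Euclidean division of α by β has a remainder smaller than β.
  Irreducible : ℤ[ d i] → ℤ[ d i] → Set
  Irreducible α β = ∀ y → norm β ℤ.≤ norm (α +ᶻ y *ᶻ β)

  module RowOrbit (2≤d : 2 ≤ d) (α β : ℤ[ d i]) where

    -- With E(x) = (x 1 ; -1 0), these are, up to sign,
    -- the rows (α + yβ , β) E(x₁) ⋯ E(xₙ) in which every xᵢ has norm at least 4.
    data Ascent : ℤ[ d i] → ℤ[ d i] → Set where
      base : ∀ y → Ascent (α +ᶻ y *ᶻ β) β
      step : ∀ x {q p} → Big x → Ascent q p → Ascent (x *ᶻ q +ᶻ -ᶻ p) q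
      neg  : ∀ {q p} → Ascent q p → Ascent (-ᶻ q) (-ᶻ p)

    -- The last letter is unrestricted: adding a multiple of the second entry to the first changes
    -- only that letter, or `y` in `root`.
    data Orbit : ℤ[ d i] → ℤ[ d i] → Set where
      root : ∀ y → Orbit (α +ᶻ y *ᶻ β) β
      edge : ∀ {q p} y → Ascent q p → Orbit (y *ᶻ q +ᶻ -ᶻ p) q
      neg  : ∀ {a b} → Orbit a b → Orbit (-ᶻ a) (-ᶻ b)

    ascent⊆orbit : ∀ {q p} → Ascent q p → Orbit q p
    ascent⊆orbit (base y)         = root y
    ascent⊆orbit (step x big h) = edge x h
    ascent⊆orbit (neg h)          = neg (ascent⊆orbit h)

    orbit-lower : ∀ {a b} → Orbit a b → ∀ z → Orbit (a +ᶻ z *ᶻ b) b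
    orbit-lower (root y) z = subst (λ a → Orbit a β) (lemma α β y z) (root (y +ᶻ z))
      where
      lemma : ∀ α β y z → α +ᶻ (y +ᶻ z) *ᶻ β ≡ α +ᶻ y *ᶻ β +ᶻ z *ᶻ β
      lemma = solve 4 (λ α β y z → α :+ (y :+ z) :* β := α :+ y :* β :+ z :* β) refl
    orbit-lower (edge {q} {p} y h) z = subst (λ a → Orbit a q) (lemma q p y z) (edge (y +ᶻ z) h)
      where
      lemma : ∀ q p y z → (y +ᶻ z) *ᶻ q +ᶻ -ᶻ p ≡ y *ᶻ q +ᶻ -ᶻ p +ᶻ z *ᶻ q
      lemma = solve 4 (λ q p y z → (y :+ z) :* q :+ :- p := y :* q :+ :- p :+ z :* q) refl
    orbit-lower (neg {a} {b} h) z = subst (λ a → Orbit a (-ᶻ b)) (lemma a b z) (neg (orbit-lower h z))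
      where
      lemma : ∀ a b z → -ᶻ (a +ᶻ z *ᶻ b) ≡ -ᶻ a +ᶻ z *ᶻ -ᶻ b
      lemma = solve 3 (λ a b z → :- (a :+ z :* b) := :- a :+ z :* :- b) refl

    -- The relation E(x) E(1) E(y) = E(x - 1) E(y - 1)
    -- removes a factor E(±1) from a word.
    fold₊ : ∀ {q p} → Ascent q p → Orbit (-ᶻ q) (q +ᶻ -ᶻ p)
    -- The target is (q , p) E(1) E(0), so the relation lowers the preceding letter by 1 and leaves
    -- a final E(-1).
    fold₊ (base y) = subst₂ Orbit (lemma₁ α β y) (lemma₂ α β y) (edge (-ᶻ 1ᶻ) (base (y +ᶻ -ᶻ 1ᶻ)))
      where
      lemma₁ : ∀ α β y → -ᶻ 1ᶻ *ᶻ (α +ᶻ (y +ᶻ -ᶻ 1ᶻ) *ᶻ β) +ᶻ -ᶻ β ≡ -ᶻ (α +ᶻ y *ᶻ β)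
      lemma₁ = solve 3 (λ α β y →
        :- con 1ℤ :* (α :+ (y :+ :- con 1ℤ) :* β) :+ :- β := :- (α :+ y :* β)) refl

      lemma₂ : ∀ α β y → α +ᶻ (y +ᶻ -ᶻ 1ᶻ) *ᶻ β ≡ α +ᶻ y *ᶻ β +ᶻ -ᶻ β
      lemma₂ = solve 3 (λ α β y → α :+ (y :+ :- con 1ℤ) :* β := α :+ y :* β :+ :- β) refl
    fold₊ (step x {q} {p} big h) = subst (λ x → Orbit (-ᶻ (x *ᶻ q +ᶻ -ᶻ p)) (x *ᶻ q +ᶻ -ᶻ p +ᶻ -ᶻ q))
      (lemma x) (go (x +ᶻ -ᶻ 1ᶻ) (subst Big (sym (lemma x)) big) (big⊎small 2≤d (x +ᶻ -ᶻ 1ᶻ)))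
      where
      lemma : ∀ x → x +ᶻ -ᶻ 1ᶻ +ᶻ 1ᶻ ≡ x
      lemma = solve 1 (λ x → x :+ :- con 1ℤ :+ con 1ℤ := x) refl

      lemma₁ : ∀ x q p → -ᶻ 1ᶻ *ᶻ (x *ᶻ q +ᶻ -ᶻ p) +ᶻ -ᶻ q ≡ -ᶻ ((x +ᶻ 1ᶻ) *ᶻ q +ᶻ -ᶻ p)
      lemma₁ = solve 3 (λ x q p →
        :- con 1ℤ :* (x :* q :+ :- p) :+ :- q := :- ((x :+ con 1ℤ) :* q :+ :- p)) refl

      lemma₂ : ∀ x q p → x *ᶻ q +ᶻ -ᶻ p ≡ (x +ᶻ 1ᶻ) *ᶻ q +ᶻ -ᶻ p +ᶻ -ᶻ q
      lemma₂ = solve 3 (λ x q p → x :* q :+ :- p := (x :+ con 1ℤ) :* q :+ :- p :+ :- q) refl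

      lemma₃ : ∀ q p → -ᶻ q +ᶻ -ᶻ 1ᶻ *ᶻ (q +ᶻ -ᶻ p) ≡ -ᶻ ((1ᶻ +ᶻ 1ᶻ) *ᶻ q +ᶻ -ᶻ p)
      lemma₃ = solve 2 (λ q p →
        :- q :+ :- con 1ℤ :* (q :+ :- p) := :- ((con 1ℤ :+ con 1ℤ) :* q :+ :- p)) refl

      lemma₄ : ∀ q p → q +ᶻ -ᶻ p ≡ (1ᶻ +ᶻ 1ᶻ) *ᶻ q +ᶻ -ᶻ p +ᶻ -ᶻ q
      lemma₄ = solve 2 (λ q p → q :+ :- p := (con 1ℤ :+ con 1ℤ) :* q :+ :- p :+ :- q) refl

      -- `go` takes the lowered letter, so the original one is x + 1. That one is `Big`, which
      -- excludes x = 0 and x = -1.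
      go : ∀ x → Big (x +ᶻ 1ᶻ) → Big x ⊎ Small x →
        Orbit (-ᶻ ((x +ᶻ 1ᶻ) *ᶻ q +ᶻ -ᶻ p)) ((x +ᶻ 1ᶻ) *ᶻ q +ᶻ -ᶻ p +ᶻ -ᶻ q)
      go x _   (inj₁ big)   = subst₂ Orbit (lemma₁ x q p) (lemma₂ x q p) (edge (-ᶻ 1ᶻ) (step x big h))
      go _ big (inj₂ is-0)  = contradiction big (¬big 1ℤ (s≤s z≤n))
      -- A letter 2 becomes 1, which is folded in turn; `orbit-lower` then changes the trailing E(0)
      -- into E(-1).
      go _ _   (inj₂ is-1)  = subst₂ Orbit (lemma₃ q p) (lemma₄ q p) (orbit-lower (fold₊ h) (-ᶻ 1ᶻ))
      go _ big (inj₂ is--1) = contradiction big (¬big 0ℤ z≤n)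
    fold₊ (neg {q} {p} h) = subst (Orbit _) (lemma q p) (neg (fold₊ h))
      where
      lemma : ∀ q p → -ᶻ (q +ᶻ -ᶻ p) ≡ -ᶻ q +ᶻ -ᶻ (-ᶻ p)
      lemma = solve 2 (λ q p → :- (q :+ :- p) := :- q :+ :- :- p) refl

    -- The companion relation is E(x) E(-1) E(y) = -E(x + 1) E(y + 1). Its sign is absorbed by
    -- `neg`, and the recursion now occurs at the letter -2.
    fold₋ : ∀ {q p} → Ascent q p → Orbit (-ᶻ q) (-ᶻ q +ᶻ -ᶻ p)
    fold₋ (base y) = subst₂ Orbit (lemma₁ α β y) (lemma₂ α β y) (edge 1ᶻ (neg (base (y +ᶻ 1ᶻ))))
      where
      lemma₁ : ∀ α β y → 1ᶻ *ᶻ -ᶻ (α +ᶻ (y +ᶻ 1ᶻ) *ᶻ β) +ᶻ -ᶻ (-ᶻ β) ≡ -ᶻ (α +ᶻ y *ᶻ β)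
      lemma₁ = solve 3 (λ α β y →
        con 1ℤ :* :- (α :+ (y :+ con 1ℤ) :* β) :+ :- :- β := :- (α :+ y :* β)) refl

      lemma₂ : ∀ α β y → -ᶻ (α +ᶻ (y +ᶻ 1ᶻ) *ᶻ β) ≡ -ᶻ (α +ᶻ y *ᶻ β) +ᶻ -ᶻ β
      lemma₂ = solve 3 (λ α β y → :- (α :+ (y :+ con 1ℤ) :* β) := :- (α :+ y :* β) :+ :- β) refl
    fold₋ (step x {q} {p} big h) = subst (λ x → Orbit (-ᶻ (x *ᶻ q +ᶻ -ᶻ p)) (-ᶻ (x *ᶻ q +ᶻ -ᶻ p) +ᶻ -ᶻ q))
      (lemma x) (go (x +ᶻ 1ᶻ) (subst Big (sym (lemma x)) big) (big⊎small 2≤d (x +ᶻ 1ᶻ)))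
      where
      lemma : ∀ x → x +ᶻ 1ᶻ +ᶻ -ᶻ 1ᶻ ≡ x
      lemma = solve 1 (λ x → x :+ con 1ℤ :+ :- con 1ℤ := x) refl

      lemma₁ : ∀ x q p → 1ᶻ *ᶻ -ᶻ (x *ᶻ q +ᶻ -ᶻ p) +ᶻ -ᶻ (-ᶻ q) ≡ -ᶻ ((x +ᶻ -ᶻ 1ᶻ) *ᶻ q +ᶻ -ᶻ p)
      lemma₁ = solve 3 (λ x q p →
        con 1ℤ :* :- (x :* q :+ :- p) :+ :- :- q := :- ((x :+ :- con 1ℤ) :* q :+ :- p)) refl

      lemma₂ : ∀ x q p → -ᶻ (x *ᶻ q +ᶻ -ᶻ p) ≡ -ᶻ ((x +ᶻ -ᶻ 1ᶻ) *ᶻ q +ᶻ -ᶻ p) +ᶻ -ᶻ q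
      lemma₂ = solve 3 (λ x q p →
        :- (x :* q :+ :- p) := :- ((x :+ :- con 1ℤ) :* q :+ :- p) :+ :- q) refl

      lemma₃ : ∀ q p → -ᶻ (-ᶻ q) +ᶻ 1ᶻ *ᶻ -ᶻ (-ᶻ q +ᶻ -ᶻ p) ≡ -ᶻ ((-ᶻ 1ᶻ +ᶻ -ᶻ 1ᶻ) *ᶻ q +ᶻ -ᶻ p)
      lemma₃ = solve 2 (λ q p →
        :- :- q :+ con 1ℤ :* :- (:- q :+ :- p) := :- ((:- con 1ℤ :+ :- con 1ℤ) :* q :+ :- p)) refl

      lemma₄ : ∀ q p → -ᶻ (-ᶻ q +ᶻ -ᶻ p) ≡ -ᶻ ((-ᶻ 1ᶻ +ᶻ -ᶻ 1ᶻ) *ᶻ q +ᶻ -ᶻ p) +ᶻ -ᶻ q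
      lemma₄ = solve 2 (λ q p →
        :- (:- q :+ :- p) := :- ((:- con 1ℤ :+ :- con 1ℤ) :* q :+ :- p) :+ :- q) refl

      go : ∀ x → Big (x +ᶻ -ᶻ 1ᶻ) → Big x ⊎ Small x →
        Orbit (-ᶻ ((x +ᶻ -ᶻ 1ᶻ) *ᶻ q +ᶻ -ᶻ p)) (-ᶻ ((x +ᶻ -ᶻ 1ᶻ) *ᶻ q +ᶻ -ᶻ p) +ᶻ -ᶻ q)
      go x _   (inj₁ big)   = subst₂ Orbit (lemma₁ x q p) (lemma₂ x q p) (edge 1ᶻ (neg (step x big h)))
      go _ big (inj₂ is-0)  = contradiction big (¬big -1ℤ (s≤s z≤n))
      go _ big (inj₂ is-1)  = contradiction big (¬big 0ℤ z≤n)
      go _ _   (inj₂ is--1) = subst₂ Orbit (lemma₃ q p) (lemma₄ q p) (orbit-lower (neg (fold₋ h)) 1ᶻ)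
    fold₋ (neg {q} {p} h) = subst (Orbit _) (lemma q p) (neg (fold₋ h))
      where
      lemma : ∀ q p → -ᶻ (-ᶻ q +ᶻ -ᶻ p) ≡ -ᶻ (-ᶻ q) +ᶻ -ᶻ (-ᶻ p)
      lemma = solve 2 (λ q p → :- (:- q :+ :- p) := :- :- q :+ :- :- p) refl

    -- This is multiplication by E(0), which makes the last letter an inner one. A `Big` letter
    -- extends the ascent, 0 cancels by E(0) E(0) = -1, and ±1 is folded away.
    orbit-turn : ∀ {a b} → Orbit a b → Orbit (-ᶻ b) a
    orbit-turn (root y) = subst (λ b → Orbit b (α +ᶻ y *ᶻ β)) (lemma (α +ᶻ y *ᶻ β) β) (edge 0ᶻ (base y))
      where
      lemma : ∀ q p → 0ᶻ *ᶻ q +ᶻ -ᶻ p ≡ -ᶻ p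
      lemma = solve 2 (λ q p → con 0ℤ :* q :+ :- p := :- p) refl
    orbit-turn (edge {q} {p} y h) = go y (big⊎small 2≤d y)
      where
      lemma₀ : ∀ q p → 0ᶻ *ᶻ q +ᶻ -ᶻ p ≡ -ᶻ p
      lemma₀ = solve 2 (λ q p → con 0ℤ :* q :+ :- p := :- p) refl

      lemma₊ : ∀ q p → q +ᶻ -ᶻ p ≡ 1ᶻ *ᶻ q +ᶻ -ᶻ p
      lemma₊ = solve 2 (λ q p → q :+ :- p := con 1ℤ :* q :+ :- p) refl

      lemma₋ : ∀ q p → -ᶻ q +ᶻ -ᶻ p ≡ -ᶻ 1ᶻ *ᶻ q +ᶻ -ᶻ p
      lemma₋ = solve 2 (λ q p → :- q :+ :- p := :- con 1ℤ :* q :+ :- p) refl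

      go : ∀ y → Big y ⊎ Small y → Orbit (-ᶻ q) (y *ᶻ q +ᶻ -ᶻ p)
      go y (inj₁ big)   = subst (λ a → Orbit a (y *ᶻ q +ᶻ -ᶻ p)) (lemma₀ (y *ᶻ q +ᶻ -ᶻ p) q)
        (edge 0ᶻ (step y big h))
      go _ (inj₂ is-0)  = subst (Orbit _) (sym (lemma₀ q p)) (neg (ascent⊆orbit h))
      go _ (inj₂ is-1)  = subst (Orbit _) (lemma₊ q p) (fold₊ h)
      go _ (inj₂ is--1) = subst (Orbit _) (lemma₋ q p) (fold₋ h)
    orbit-turn (neg h) = neg (orbit-turn h)

    -- The matrix `upper z` equals -E(0) L E(0) with L the matrix `lower (-ᶻ z)`.
    orbit-upper : ∀ {a b} → Orbit a b → ∀ z → Orbit a (z *ᶻ a +ᶻ b)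
    orbit-upper {a} {b} h z = subst₂ Orbit (lemma₁ a) (lemma₂ a b z)
      (orbit-turn (neg (orbit-lower (orbit-turn h) (-ᶻ z))))
      where
      lemma₁ : ∀ a → -ᶻ (-ᶻ a) ≡ a
      lemma₁ = solve 1 (λ a → :- :- a := a) refl

      lemma₂ : ∀ a b z → -ᶻ (-ᶻ b +ᶻ -ᶻ z *ᶻ a) ≡ z *ᶻ a +ᶻ b
      lemma₂ = solve 3 (λ a b z → :- (:- b :+ :- z :* a) := z :* a :+ b) refl

    start : Orbit α β
    start = subst (λ a → Orbit a β) (lemma α β) (root 0ᶻ)
      where
      lemma : ∀ α β → α +ᶻ 0ᶻ *ᶻ β ≡ α
      lemma = solve 2 (λ α β → α :+ con 0ℤ :* β := α) refl

    -- The entries keep the unsimplified form in which the matrix product computes.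
    upper-row : ∀ a b z → Orbit a b → Orbit (a *ᶻ 1ᶻ +ᶻ b *ᶻ 0ᶻ) (a *ᶻ z +ᶻ b *ᶻ 1ᶻ)
    upper-row a b z h = subst₂ Orbit (lemma₁ a b) (lemma₂ a b z) (orbit-upper h z)
      where
      lemma₁ : ∀ a b → a ≡ a *ᶻ 1ᶻ +ᶻ b *ᶻ 0ᶻ
      lemma₁ = solve 2 (λ a b → a := a :* con 1ℤ :+ b :* con 0ℤ) refl

      lemma₂ : ∀ a b z → z *ᶻ a +ᶻ b ≡ a *ᶻ z +ᶻ b *ᶻ 1ᶻ
      lemma₂ = solve 3 (λ a b z → z :* a :+ b := a :* z :+ b :* con 1ℤ) refl

    lower-row : ∀ a b z → Orbit a b → Orbit (a *ᶻ 1ᶻ +ᶻ b *ᶻ z) (a *ᶻ 0ᶻ +ᶻ b *ᶻ 1ᶻ)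
    lower-row a b z h = subst₂ Orbit (lemma₁ a b z) (lemma₂ a b) (orbit-lower h z)
      where
      lemma₁ : ∀ a b z → a +ᶻ z *ᶻ b ≡ a *ᶻ 1ᶻ +ᶻ b *ᶻ z
      lemma₁ = solve 3 (λ a b z → a :+ z :* b := a :* con 1ℤ :+ b :* z) refl

      lemma₂ : ∀ a b → b ≡ a *ᶻ 0ᶻ +ᶻ b *ᶻ 1ᶻ
      lemma₂ = solve 2 (λ a b → b := a :* con 0ℤ :+ b :* con 1ℤ) refl

    -- Norm bounds on the orbit of an irreducible row.

    module _ (irr : Irreducible α β) where

      -- The second inequality is the hypothesis of `norm-growth` at the next letter; irreducibility
      -- supplies it at the base.
      ascent-norm : ∀ {q p} → Ascent q p → norm β ℤ.≤ norm p × norm p ℤ.≤ norm q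
      ascent-norm (base y) = ℤ.≤-refl , irr y
      ascent-norm (step x big h) with ascent-norm h
      ... | β≤p , p≤q = ℤ.≤-trans β≤p p≤q , norm-growth {x} big p≤q
      ascent-norm (neg {q} {p} h) = subst₂ (λ m n → norm β ℤ.≤ m × m ℤ.≤ n)
        (sym (norm-neg p)) (sym (norm-neg q)) (ascent-norm h)

      -- The uncontrolled last letter affects only the first entry, so the second keeps the bound of
      -- the ascent.
      orbit-norm : ∀ {a b} → Orbit a b → norm β ℤ.≤ norm b
      orbit-norm (root y)        = ℤ.≤-refl
      orbit-norm (edge y h)      = let β≤p , p≤q = ascent-norm h in ℤ.≤-trans β≤p p≤q
      orbit-norm (neg {b = b} h) = subst (norm β ℤ.≤_) (sym (norm-neg b)) (orbit-norm h)


  -- From rows to cosets of E₂.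

  E₂ᶻ = E₂ (ℤ[di]-commutativeRing d)

  open Group (SL₂ (ℤ[di]-commutativeRing d))
    using (_∙_; _⁻¹; _≈_; ∙-congˡ; ⁻¹-cong; inverseʳ) renaming (sym to ≈-sym)
  open SL₂-Matrix

  E₂-norm : 2 ≤ d → ∀ {M h} → Irreducible (e₁₁ M) (e₁₂ M) → h ∈ Subgroup.Member E₂ᶻ →
    norm (e₁₂ M) ℤ.≤ norm (e₁₂ (M ∙ h))
  E₂-norm 2≤d {M} {h} irr h∈ = orbit-norm irr {e₁₁ (M ∙ h)} {e₁₂ (M ∙ h)}
    (generated-stable
      {G = SL₂ (ℤ[di]-commutativeRing d)} {S = IsElementary (ℤ[di]-commutativeRing d)} InOrbit
      (λ {x} {y} → resp-≈ {x} {y}) (λ {g} {x} → times {g} {x}) (λ {g} {x} → times⁻¹ {g} {x})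
      {h} {M} h∈ start)
    where
    open RowOrbit 2≤d (e₁₁ M) (e₁₂ M)

    -- Right multiplication acts on each row separately, so it suffices to follow the first row.
    InOrbit : Pred (SL₂-Matrix (ℤ[di]-commutativeRing d)) 0ℓ
    InOrbit N = Orbit (e₁₁ N) (e₁₂ N)

    resp-≈ : ∀ {N N′} → N ≈ N′ → InOrbit N → InOrbit N′
    resp-≈ (mk≈ p q _ _) = subst₂ Orbit p q

    times : ∀ {g N} → IsElementary (ℤ[di]-commutativeRing d) g → InOrbit N → InOrbit (N ∙ g)
    times {g} {N} (z , inj₁ g≈) h = resp-≈
      (∙-congˡ {N} (≈-sym g≈)) (upper-row (e₁₁ N) (e₁₂ N) z h)
    times {g} {N} (z , inj₂ g≈) h = resp-≈
      (∙-congˡ {N} (≈-sym g≈)) (lower-row (e₁₁ N) (e₁₂ N) z h)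

    -- The inverse has an entry -0, which reduces to 0, so the row lemmas apply directly at `-ᶻ z`.
    times⁻¹ : ∀ {g N} → IsElementary (ℤ[di]-commutativeRing d) g → InOrbit N → InOrbit (N ∙ g ⁻¹)
    times⁻¹ {g} {N} (z , inj₁ g≈) h = resp-≈
      (∙-congˡ {N} (⁻¹-cong (≈-sym g≈))) (upper-row (e₁₁ N) (e₁₂ N) (-ᶻ z) h)
    times⁻¹ {g} {N} (z , inj₂ g≈) h = resp-≈
      (∙-congˡ {N} (⁻¹-cong (≈-sym g≈))) (lower-row (e₁₁ N) (e₁₂ N) (-ᶻ z) h)

  -- Irreducible rows and infinite index.

  -- (u + v·di) / 2v has imaginary part di/2, hence distance at least d/2 ≥ 1
  -- from ℤ[di].
  half-irreducible : 2 ≤ d → ∀ u v → Irreducible (u + v di) (fromℤ (+ 2 ℤ.* v))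
  half-irreducible 2≤d u v (s + t di) = ℤ.0≤i-j⇒j≤i (subst (0ℤ ℤ.≤_)
    (lemma (+ d ℤ.* + d) u v s t)
    (0≤i+j
      (0≤i+j (0≤i*i (u ℤ.+ s ℤ.* (+ 2 ℤ.* v)))
        (0≤i*j (ℤ.i≤j⇒0≤j-i (4≤d*d 2≤d)) (0≤i*i (v ℤ.+ t ℤ.* (+ 2 ℤ.* v)))))
      (0≤i*j {+ 16} (+≤+ z≤n) (0≤i*j (0≤i*i v) (0≤i*[i+1] t)))))
    where
    -- Write d² = (d² - 4) + 4 and use 4v²(2t + 1)² - 4v² = 16v²t(t + 1): the excess is then a sum
    -- of three nonnegative terms.
    lemma : ∀ e u v s t →
      (u ℤ.+ s ℤ.* (+ 2 ℤ.* v)) ℤ.* (u ℤ.+ s ℤ.* (+ 2 ℤ.* v))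
        ℤ.+ (e ℤ.- + 4) ℤ.* ((v ℤ.+ t ℤ.* (+ 2 ℤ.* v)) ℤ.* (v ℤ.+ t ℤ.* (+ 2 ℤ.* v)))
        ℤ.+ + 16 ℤ.* (v ℤ.* v ℤ.* (t ℤ.* (t ℤ.+ 1ℤ)))
      ≡ (u ℤ.+ (s ℤ.* (+ 2 ℤ.* v) ℤ.- e ℤ.* (t ℤ.* 0ℤ))) ℤ.* (u ℤ.+ (s ℤ.* (+ 2 ℤ.* v) ℤ.- e ℤ.* (t ℤ.* 0ℤ)))
        ℤ.+ e ℤ.* ((v ℤ.+ (s ℤ.* 0ℤ ℤ.+ t ℤ.* (+ 2 ℤ.* v))) ℤ.* (v ℤ.+ (s ℤ.* 0ℤ ℤ.+ t ℤ.* (+ 2 ℤ.* v))))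
        ℤ.- ((+ 2 ℤ.* v) ℤ.* (+ 2 ℤ.* v) ℤ.+ e ℤ.* (0ℤ ℤ.* 0ℤ))
    lemma = ℤ-Solver.solve-∀

  -- (1 + 2k·di  4k ; kd²  1 - 2k·di)
  special : ℤ → SL₂-Matrix (ℤ[di]-commutativeRing d)
  special k = mat (1ℤ + (+ 2 ℤ.* k) di) (fromℤ (+ 2 ℤ.* (+ 2 ℤ.* k)))
    (fromℤ (k ℤ.* (+ d ℤ.* + d))) (1ℤ + (ℤ.- (+ 2 ℤ.* k)) di)
    (cong₂ _+_di (re (+ d ℤ.* + d) k) (im (+ d ℤ.* + d) k))
    where
    re : ∀ e k →
      1ℤ ℤ.* 1ℤ ℤ.- e ℤ.* ((+ 2 ℤ.* k) ℤ.* ℤ.- (+ 2 ℤ.* k))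
        ℤ.- ((+ 2 ℤ.* (+ 2 ℤ.* k)) ℤ.* (k ℤ.* e) ℤ.- e ℤ.* (0ℤ ℤ.* 0ℤ)) ≡ 1ℤ
    re = ℤ-Solver.solve-∀

    im : ∀ e k →
      1ℤ ℤ.* ℤ.- (+ 2 ℤ.* k) ℤ.+ (+ 2 ℤ.* k) ℤ.* 1ℤ
        ℤ.- ((+ 2 ℤ.* (+ 2 ℤ.* k)) ℤ.* 0ℤ ℤ.+ 0ℤ ℤ.* (k ℤ.* e)) ≡ 0ℤ
    im = ℤ-Solver.solve-∀

  -- In a common coset, `special l` is `special k` times an element of E₂, so `E₂-norm` compares the
  -- norms 16k² and 16l² of the upper right entries.
  special-coset : 2 ≤ d → ∀ k l →
    Setoid._≈_ (leftCosets E₂ᶻ) (special k) (special l) → k ℤ.* k ℤ.≤ l ℤ.* l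
  special-coset 2≤d k l h∈ = ℤ.*-cancelˡ-≤-pos _ _ (+ 16) (subst₂ ℤ._≤_ (norm-e₁₂ k) (norm-e₁₂ l)
    (subst (λ b → norm (e₁₂ (special k)) ℤ.≤ norm b)
      (_≈ᴹ_.e₁₂≈ (\\-leftDividesˡ (special k) (special l)))
      -- The entry 4k is stored as 2(2k) to match `half-irreducible` at u = 1, v = 2k.
      (E₂-norm 2≤d {special k} (half-irreducible 2≤d 1ℤ (+ 2 ℤ.* k)) h∈)))
    where
    open GroupProperties (SL₂ (ℤ[di]-commutativeRing d)) using (\\-leftDividesˡ)

    lemma : ∀ k → + 2 ℤ.* (+ 2 ℤ.* k) ℤ.* (+ 2 ℤ.* (+ 2 ℤ.* k)) ≡ + 16 ℤ.* (k ℤ.* k)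
    lemma = ℤ-Solver.solve-∀

    norm-e₁₂ : ∀ k → norm (e₁₂ (special k)) ≡ + 16 ℤ.* (k ℤ.* k)
    norm-e₁₂ k = trans (norm-fromℤ (+ 2 ℤ.* (+ 2 ℤ.* k))) (lemma k)

  special-coset⁺ : 2 ≤ d → ∀ m n →
    Setoid._≈_ (leftCosets E₂ᶻ) (special (+ suc m)) (special (+ suc n)) → m ≤ n
  special-coset⁺ 2≤d m n m≈n = ℕ.≮⇒≥ λ n<m → ℕ.<⇒≱ (ℕ.*-mono-< (s≤s n<m) (s≤s n<m))
    -- For successors the integer squares reduce to the form `+ n`, as `drop‿+≤+` requires.
    (ℤ.drop‿+≤+ (special-coset 2≤d (+ suc m) (+ suc n) m≈n))

  E₂-infiniteIndex : 2 ≤ d → HasInfiniteIndex E₂ᶻ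
  E₂-infiniteIndex 2≤d = record
    { to        = λ n → special (+ suc n)
    ; cong      = λ { {n} refl → Setoid.refl (leftCosets E₂ᶻ) {special (+ suc n)} }
    ; injective = λ {m} {n} m≈n → ℕ.≤-antisym (special-coset⁺ 2≤d m n m≈n)
        (special-coset⁺ 2≤d n m
          (Setoid.sym (leftCosets E₂ᶻ) {special (+ suc m)} {special (+ suc n)} m≈n))
    }

  -- Failure of normality.

  -- (4  1 - 2di ; -1 - 2di  -d²), chosen so that conjugating upper 1 gives a matrix
  -- whose first row (5 + 8di , 16) is of the form in half-irreducible.
  conjugator : SL₂-Matrix (ℤ[di]-commutativeRing d)
  conjugator = mat (fromℤ (+ 4)) (1ℤ + -[1+ 1 ] di) (-1ℤ + -[1+ 1 ] di) (fromℤ (ℤ.- (+ d ℤ.* + d)))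
    (cong₂ _+_di (re (+ d ℤ.* + d)) (im (+ d ℤ.* + d)))
    where
    re : ∀ e →
      + 4 ℤ.* ℤ.- e ℤ.- e ℤ.* (0ℤ ℤ.* 0ℤ) ℤ.- (1ℤ ℤ.* -1ℤ ℤ.- e ℤ.* (-[1+ 1 ] ℤ.* -[1+ 1 ])) ≡ 1ℤ
    re = ℤ-Solver.solve-∀

    im : ∀ e → + 4 ℤ.* 0ℤ ℤ.+ 0ℤ ℤ.* ℤ.- e ℤ.- (1ℤ ℤ.* -[1+ 1 ] ℤ.+ -[1+ 1 ] ℤ.* -1ℤ) ≡ 0ℤ
    im = ℤ-Solver.solve-∀

  -- For g = (a b ; c e), conjugating `upper 1` gives the first row (1 - ac , a²); the 1 is the
  -- determinant ae - bc.
  conjugate-e₁₁ :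
    e₁₁ ((conjugator ∙ upper (ℤ[di]-commutativeRing d) 1ᶻ) ∙ conjugator ⁻¹) ≡ (+ 5) + (+ 8) di
  conjugate-e₁₁ = trans (lemma (e₁₁ conjugator) (e₁₂ conjugator) (e₂₁ conjugator) (e₂₂ conjugator))
    (cong₂ (λ x y → x +ᶻ -ᶻ y) (det≈1 conjugator) (fromℤ-* (+ 4) -1ℤ -[1+ 1 ]))
    where
    lemma : ∀ a b c e → (a *ᶻ 1ᶻ +ᶻ b *ᶻ 0ᶻ) *ᶻ e +ᶻ (a *ᶻ 1ᶻ +ᶻ b *ᶻ 1ᶻ) *ᶻ -ᶻ c
      ≡ a *ᶻ e +ᶻ -ᶻ (b *ᶻ c) +ᶻ -ᶻ (a *ᶻ c)
    lemma = solve 4 (λ a b c e →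
      (a :* con 1ℤ :+ b :* con 0ℤ) :* e :+ (a :* con 1ℤ :+ b :* con 1ℤ) :* :- c
      := a :* e :+ :- (b :* c) :+ :- (a :* c)) refl

  conjugate-e₁₂ :
    e₁₂ ((conjugator ∙ upper (ℤ[di]-commutativeRing d) 1ᶻ) ∙ conjugator ⁻¹) ≡ fromℤ (+ 16)
  conjugate-e₁₂ = trans (lemma (e₁₁ conjugator) (e₁₂ conjugator)) (fromℤ-* (+ 4) (+ 4) 0ℤ)
    where
    lemma : ∀ a b → (a *ᶻ 1ᶻ +ᶻ b *ᶻ 0ᶻ) *ᶻ -ᶻ b +ᶻ (a *ᶻ 1ᶻ +ᶻ b *ᶻ 1ᶻ) *ᶻ a ≡ a *ᶻ a
    lemma = solve 2 (λ a b →
      (a :* con 1ℤ :+ b :* con 0ℤ) :* :- b :+ (a :* con 1ℤ :+ b :* con 1ℤ) :* a := a :* a) refl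

  -- Were `M` in E₂, multiplying by its inverse would carry its first row to (1 , 0) within the
  -- orbit, making the second entry smaller than `E₂-norm` allows.
  irreducible∉E₂ : 2 ≤ d → ∀ M → Irreducible (e₁₁ M) (e₁₂ M) → 0ℤ ℤ.< norm (e₁₂ M) →
    ¬ M ∈ Subgroup.Member E₂ᶻ
  irreducible∉E₂ 2≤d M irr 0<norm M∈ = ℤ.<⇒≱ 0<norm (subst (norm (e₁₂ M) ℤ.≤_)
    (trans (cong norm (_≈ᴹ_.e₁₂≈ (inverseʳ M))) (norm-fromℤ 0ℤ))
    (E₂-norm 2≤d {M} irr (inv M∈)))

  irreducible-conjugate⇒notNormal : 2 ≤ d → ∀ g {h} → h ∈ Subgroup.Member E₂ᶻ →
    Irreducible (e₁₁ ((g ∙ h) ∙ g ⁻¹)) (e₁₂ ((g ∙ h) ∙ g ⁻¹)) →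
    0ℤ ℤ.< norm (e₁₂ ((g ∙ h) ∙ g ⁻¹)) → ¬ IsNormal E₂ᶻ
  irreducible-conjugate⇒notNormal 2≤d g {h} h∈ irr 0<norm normal =
    irreducible∉E₂ 2≤d ((g ∙ h) ∙ g ⁻¹) irr 0<norm (normal g {h} h∈)

  E₂-notNormal : 2 ≤ d → ¬ IsNormal E₂ᶻ
  E₂-notNormal 2≤d = irreducible-conjugate⇒notNormal 2≤d
    conjugator {upper (ℤ[di]-commutativeRing d) 1ᶻ}
    (gen (1ᶻ , inj₁ (mk≈ refl refl refl refl)))
    (subst₂ Irreducible (sym conjugate-e₁₁) (sym conjugate-e₁₂) (half-irreducible 2≤d (+ 5) (+ 8)))
    (subst (0ℤ ℤ.<_) (sym (trans (cong norm conjugate-e₁₂) (norm-fromℤ (+ 16)))) (ℤ.+<+ (s≤s z≤n)))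

mainTheorem1 : ∀ (d : ℕ) → 2 ≤ d →
    HasInfiniteIndex (E₂ (ℤ[di]-commutativeRing d)) ×
    ¬ IsNormal (E₂ (ℤ[di]-commutativeRing d))
mainTheorem1 d 2≤d = E₂-infiniteIndex 2≤d , E₂-notNormal 2≤d
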